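{- For all integers $k\ge1$ and $n\ge1$, $$N^{(k-1)(k-2)\cdots1k}_{21\text{ - }3}(n)=\begin{cases}0,&\text{if }k\ge3,\\ B_n-B_{n-1},&\text{if }k=2,\\ B_n,&\text{if }k=1.\end{cases}$$
   Context: A permutation $\pi=\pi_1\cdots\pi_n$ of $\{1,\dots,n\}$ contains the generalized pattern $21\text{ - }3$ if there are indices $i,j$ with $i+1<j\le n$ such that $\pi_i\pi_{i+1}\pi_j$ is order-isomorphic to $213$; otherwise it avoids it. A permutation $\pi$ begins with a pattern $p=p_1\cdots p_k$ if $n\ge k$ and $\pi_1\cdots\pi_k$ is order-isomorphic to $p$. The pattern $(k-1)(k-2)\cdots1k$ consists of $k-1,k-2,\dots,1$ in decreasing order followed by $k$ (for $k=1$ it is $1$, for $k=2$ it is $12$). $N^p_q(n)$ is the number of permutations of $\{1,\dots,n\}$ that avoid $q$ and begin with $p$. $B_m$ is the $m$th Bell number ($B_0=1$). -}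

module Defs where

open import Data.Bool using (Bool; true; false; T; T?)
open import Data.Fin using (Fin; toℕ)
import Data.Fin as Fin
import Data.Fin.Properties as Fin
open import Data.List using (List; allFin; cartesianProductWith; filter; length)
import Data.List as List
open import Data.Nat using (ℕ; zero; suc; _≤_; _<_; _≤?_; _<?_)
import Data.Nat as ℕ
open import Data.Nat.Properties using (≤-irrelevant)
open import Data.Product using (Σ; ∃; _×_; _,_; uncurry)
open import Data.Vec using (Vec; []; _∷_; _∷ʳ_; lookup; map; truncate)
import Data.Vec.Relation.Unary.AllPairs as AllPairs
open import Data.Vec.Relation.Unary.Unique.Propositional using (Unique)
open import Function using (_⇔_; mk⇔; Equivalence)
open import Relation.Binary using (IsEquivalence)
open import Relation.Binary.PropositionalEquality using (_≡_; subst)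
open import Relation.Nullary using (Dec; yes; no; ¬_; ¬?; _×-dec_; _→-dec_; map′)
open import Relation.Unary using (Decidable)

-- All vectors of length n with entries from xs, each listed exactly once
-- when xs has no repeated entries.
vectors : {A : Set} → List A → (n : ℕ) → List (Vec A n)
vectors xs zero    = [] List.∷ List.[]
vectors xs (suc n) = cartesianProductWith _∷_ xs (vectors xs n)

------------------------------------------------------------------------
-- Permutations and patterns

-- A permutation of {1,…,n} is written in one-line notation, with its letters
-- shifted down to 0,…,n-1.  Repetition-free words of length n over Fin n are
-- exactly the permutations.
Word : ℕ → Set
Word n = Vec (Fin n) n

IsPermutation : ∀ {n} → Word n → Set
IsPermutation = Unique

OrderIsomorphic : ∀ {k} → Vec ℕ k → Vec ℕ k → Set
OrderIsomorphic u v =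
  ∀ a b → (lookup u a < lookup u b) ⇔ (lookup v a < lookup v b)

Contains21-3 : ∀ {n} → Word n → Set
Contains21-3 {n} π =
  ∃ λ (i : Fin n) → ∃ λ (i⁺ : Fin n) → ∃ λ (j : Fin n) →
    toℕ i⁺ ≡ suc (toℕ i) × i⁺ Fin.< j ×
    OrderIsomorphic
      (toℕ (lookup π i) ∷ toℕ (lookup π i⁺) ∷ toℕ (lookup π j) ∷ [])
      (2 ∷ 1 ∷ 3 ∷ [])

Avoids21-3 : ∀ {n} → Word n → Set
Avoids21-3 π = ¬ Contains21-3 π

BeginsWith : ∀ {k n} → Vec ℕ k → Word n → Set
BeginsWith {k} {n} p π =
  Σ (k ≤ n) λ k≤n → OrderIsomorphic (truncate k≤n (map toℕ π)) p

descending : (m : ℕ) → Vec ℕ m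
descending zero    = []
descending (suc m) = suc m ∷ descending m

-- The pattern (k-1)(k-2)⋯1k; the value at k = 0 is a dummy.
descendingThenMax : (k : ℕ) → Vec ℕ k
descendingThenMax zero    = []
descendingThenMax (suc m) = descending m ∷ʳ suc m

isPermutation? : ∀ {n} → Decidable (IsPermutation {n})
isPermutation? = AllPairs.allPairs? (λ x y → ¬? (x Fin.≟ y))

orderIsomorphic? : ∀ {k} (u v : Vec ℕ k) → Dec (OrderIsomorphic u v)
orderIsomorphic? u v = Fin.all? λ a → Fin.all? λ b →
  let P? = lookup u a <? lookup u b
      Q? = lookup v a <? lookup v b
  in map′ (uncurry mk⇔) (λ e → Equivalence.to e , Equivalence.from e)
       ((P? →-dec Q?) ×-dec (Q? →-dec P?))

contains21-3? : ∀ {n} → Decidable (Contains21-3 {n})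
contains21-3? π = Fin.any? λ i → Fin.any? λ i⁺ → Fin.any? λ j →
  (toℕ i⁺ ℕ.≟ suc (toℕ i)) ×-dec (i⁺ Fin.<? j) ×-dec
  orderIsomorphic?
    (toℕ (lookup π i) ∷ toℕ (lookup π i⁺) ∷ toℕ (lookup π j) ∷ [])
    (2 ∷ 1 ∷ 3 ∷ [])

avoids21-3? : ∀ {n} → Decidable (Avoids21-3 {n})
avoids21-3? π = ¬? (contains21-3? π)

beginsWith? : ∀ {k n} (p : Vec ℕ k) → Decidable (BeginsWith {k} {n} p)
beginsWith? {k} {n} p π with k ≤? n
... | no  k≰n = no λ (k≤n , _) → k≰n k≤n
... | yes k≤n = map′ (k≤n ,_)
  (λ (k≤n′ , iso) →
    subst (λ le → OrderIsomorphic (truncate le (map toℕ π)) p)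
          (≤-irrelevant k≤n′ k≤n) iso)
  (orderIsomorphic? (truncate k≤n (map toℕ π)) p)

-- N p n is the number of permutations of {1,…,n} that avoid 21-3 and begin
-- with p.
N : ∀ {k} → Vec ℕ k → ℕ → ℕ
N p n = length (filter
  (λ π → isPermutation? π ×-dec avoids21-3? π ×-dec beginsWith? p π)
  (vectors (allFin n) n))

------------------------------------------------------------------------
-- Bell numbers

-- A binary relation on Fin n, as its incidence matrix.
Matrix : ℕ → Set
Matrix n = Vec (Vec Bool n) n

Related : ∀ {n} → Matrix n → Fin n → Fin n → Set
Related R i j = T (lookup (lookup R i) j)

isEquivalence? : ∀ {n} (R : Matrix n) → Dec (IsEquivalence (Related R))
isEquivalence? R = map′
  (λ (r , s , t) → record
    { refl  = λ {x} → r x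
    ; sym   = λ {x} {y} → s x y
    ; trans = λ {x} {y} {z} → t x y z
    })
  (λ eq → let open IsEquivalence eq in
    (λ x → refl {x}) , (λ x y → sym {x} {y}) , (λ x y z → trans {x} {y} {z}))
  ((Fin.all? λ x → R? x x) ×-dec
   (Fin.all? λ x → Fin.all? λ y → R? x y →-dec R? y x) ×-dec
   (Fin.all? λ x → Fin.all? λ y → Fin.all? λ z →
     R? x y →-dec (R? y z →-dec R? x z)))
  where
  R? : ∀ x y → Dec (Related R x y)
  R? x y = T? (lookup (lookup R x) y)

-- The number of partitions of an n-element set, each partition being given
-- by the equivalence relation "in the same block".
bell : ℕ → ℕ
bell n = length (filter isEquivalence?
  (vectors (vectors (true List.∷ false List.∷ List.[]) n) n))

{-# OPTIONS --safe #-}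
module Submission where

-- Let Sᵢ be the largest letter of π at or after position i.  In a permutation
-- avoiding 21-3 every descent top exceeds all later letters, so Sᵢ is the last
-- letter of the increasing run containing position i, and the runs form a set
-- partition.  Listing the blocks of a partition by decreasing maximum, each in
-- increasing order, inverts this, whence the Bell numbers.  An avoiding
-- permutation that does not begin with an ascent begins with its largest
-- letter, and removing that letter leaves an arbitrary avoiding permutation.
-- For k ≥ 3, the first two letters and the k-th already form the pattern 21-3.

open import Defs
open import Data.Bool using (true; false; T; T?)
open import Data.Empty using (⊥-elim)
open import Data.Fin using (Fin; zero; suc; toℕ; fromℕ; fromℕ<; inject₁; inject≤; lower₁;
  punchIn; punchOut)
import Data.Fin as Fin
import Data.Fin.Properties as Fin
open import Data.Integer using (+_; _-_)
import Data.Integer as ℤ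
import Data.Integer.Properties as ℤ
open import Data.List using (List; allFin; filter; length)
import Data.List as List
open import Data.List.Membership.Propositional using (_∈_)
open import Data.List.Membership.Propositional.Properties
  using (∈-filter⁺; ∈-filter⁻; ∈-cartesianProductWith⁺; ∈-allFin; ∈-∃++)
open import Data.List.Properties using (filter-≐; filter-none)
open import Data.List.Relation.Binary.Permutation.Propositional using (↭-sym)
open import Data.List.Relation.Binary.Permutation.Propositional.Properties
  using (↭-length; ∈-resp-↭; shift)
import Data.List.Relation.Unary.All as All
import Data.List.Relation.Unary.AllPairs as AllPairs
open import Data.List.Relation.Unary.Any using (here; there)
import Data.List.Relation.Unary.Unique.Propositional as List
import Data.List.Relation.Unary.Unique.Propositional.Properties as List
open import Data.Nat using (ℕ; zero; suc; _+_; _∸_; _≤_; _<_; z≤n; s≤s; s≤s⁻¹)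
import Data.Nat.Properties as ℕ
open import Data.Product using (∃; _×_; _,_; proj₁; proj₂)
open import Data.Product.Relation.Binary.Lex.Strict using (×-strictTotalOrder)
open import Data.Sum using (inj₁; inj₂)
open import Data.Vec using (Vec; []; _∷_; _∷ʳ_; lookup; map; tabulate; truncate)
open import Data.Vec.Properties
  using (∷-injective; lookup∘tabulate; tabulate∘lookup; tabulate-cong; lookup-map; lookup-truncate)
import Data.Vec.Relation.Unary.All as VecAll
import Data.Vec.Relation.Unary.All.Properties as VecAll
import Data.Vec.Relation.Unary.AllPairs as VecAllPairs
import Data.Vec.Relation.Unary.Unique.Propositional.Properties as Vec
open import Function using (_∘_; const; flip; _⇔_; mk⇔; Equivalence; Injective)
open import Level using (0ℓ)
open import Relation.Binary using (REL; StrictTotalOrder; IsEquivalence; tri<; tri≈; tri>)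
import Relation.Binary.Construct.Flip.EqAndOrd as Flip
import Relation.Binary.Construct.On as On
open import Relation.Binary.PropositionalEquality
  using (_≡_; _≢_; refl; sym; trans; cong; cong₂; subst; subst₂; module ≡-Reasoning)
open import Relation.Nullary using (Dec; yes; no; ¬_; ¬?; _×-dec_; contradiction)
open import Relation.Nullary.Decidable using (⌊_⌋; toWitness; fromWitness)
open import Relation.Unary using (Pred; Decidable)

open Equivalence using (to; from)

private
  variable
    m n : ℕ
    A B : Set

-- Counting

-- Induction on `xs`: delete from `ys` a partner `y` of the head; by injectivity the partners of the
-- other elements differ from `y` and survive. With a relation in place of a function, the same
-- lemma serves both directions of a correspondence.
length-≤ : (_∼_ : REL A B 0ℓ) {xs : List A} {ys : List B} → List.Unique xs →
  (∀ {x} → x ∈ xs → ∃ λ y → y ∈ ys × x ∼ y) →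
  (∀ {x x′ y} → x ∈ xs → x′ ∈ xs → y ∈ ys → x ∼ y → x′ ∼ y → x ≡ x′) →
  length xs ≤ length ys
length-≤ _∼_ {List.[]} _ _ _ = z≤n
length-≤ _∼_ {x List.∷ xs} (x∉xs AllPairs.∷ xs!) image inj
  with image (here refl)
... | y , y∈ys , x∼y with ∈-∃++ y∈ys
... | as , bs , refl =
  subst (suc (length xs) ≤_) (sym (↭-length (shift y as bs)))
    (s≤s (length-≤ _∼_ xs! image′
      λ p q r → inj (there p) (there q) (∈-resp-↭ (↭-sym (shift y as bs)) (there r))))
  where
  image′ : ∀ {x′} → x′ ∈ xs → ∃ λ y′ → y′ ∈ as List.++ bs × x′ ∼ y′
  image′ x′∈xs with image (there x′∈xs)
  ... | y′ , y′∈ys , x′∼y′ with ∈-resp-↭ (shift y as bs) y′∈ys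
  ... | here refl = contradiction
          (inj (here refl) (there x′∈xs) y∈ys x∼y x′∼y′) (All.lookup x∉xs x′∈xs)
  ... | there y′∈ = y′ , y′∈ , x′∼y′

Enumerates : List A → Set
Enumerates xs = List.Unique xs × (∀ x → x ∈ xs)

vectors-enumerates : {xs : List A} → Enumerates xs → ∀ n → Enumerates (vectors xs n)
vectors-enumerates _ zero = All.[] AllPairs.∷ AllPairs.[] , λ { [] → here refl }
vectors-enumerates (xs! , ∈xs) (suc n) =
  let vs! , ∈vs = vectors-enumerates (xs! , ∈xs) n in
  List.cartesianProductWith⁺ _∷_ ∷-injective xs! vs! ,
  λ { (x ∷ v) → ∈-cartesianProductWith⁺ _∷_ (∈xs x) (∈vs v) }

bools-enumerates : Enumerates (true List.∷ false List.∷ List.[])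
bools-enumerates =
  ((λ ()) All.∷ All.[]) AllPairs.∷ All.[] AllPairs.∷ AllPairs.[] ,
  λ { true → here refl ; false → there (here refl) }

allFin-enumerates : ∀ n → Enumerates (allFin n)
allFin-enumerates n = List.allFin⁺ n , ∈-allFin

module _ {P : Pred A 0ℓ} (P? : Decidable P) {Q : Pred B 0ℓ} (Q? : Decidable Q) where

  count-≤ : (_∼_ : REL A B 0ℓ) {xs : List A} {ys : List B} →
    List.Unique xs → (∀ y → y ∈ ys) →
    (∀ {x} → P x → ∃ λ y → Q y × x ∼ y) →
    (∀ {x x′ y} → P x → P x′ → Q y → x ∼ y → x′ ∼ y → x ≡ x′) →
    length (filter P? xs) ≤ length (filter Q? ys)
  count-≤ _∼_ {xs} {ys} xs! ∈ys image inj =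
    length-≤ _∼_ (List.filter⁺ P? xs!)
      (λ x∈ → let y , qy , x∼y = image (satisfies x∈)
              in y , ∈-filter⁺ Q? (∈ys y) qy , x∼y)
      (λ x∈ x′∈ y∈ → inj (satisfies x∈) (satisfies x′∈) (proj₂ (∈-filter⁻ Q? {xs = ys} y∈)))
    where
    satisfies : ∀ {x} → x ∈ filter P? xs → P x
    satisfies = proj₂ ∘ ∈-filter⁻ P? {xs = xs}

-- Double counting through one relation: `count-≤` is applied to it and to its flip, so neither map
-- of the bijection has to be written as a function on all words.
count-≡ : {P : Pred A 0ℓ} (P? : Decidable P) {Q : Pred B 0ℓ} (Q? : Decidable Q) →
  (_∼_ : REL A B 0ℓ) {xs : List A} {ys : List B} →
  Enumerates xs → Enumerates ys →
  (∀ {x} → P x → ∃ λ y → Q y × x ∼ y) →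
  (∀ {y} → Q y → ∃ λ x → P x × x ∼ y) →
  (∀ {x x′ y} → P x → P x′ → Q y → x ∼ y → x′ ∼ y → x ≡ x′) →
  (∀ {x y y′} → Q y → Q y′ → P x → x ∼ y → x ∼ y′ → y ≡ y′) →
  length (filter P? xs) ≡ length (filter Q? ys)
count-≡ P? Q? _∼_ (xs! , ∈xs) (ys! , ∈ys) image preimage inj func =
  ℕ.≤-antisym (count-≤ P? Q? _∼_ xs! ∈ys image inj)
              (count-≤ Q? P? (flip _∼_) ys! ∈xs preimage func)

count-split : {P : Pred A 0ℓ} (P? : Decidable P) {Q : Pred A 0ℓ} (Q? : Decidable Q)
  (xs : List A) →
  length (filter (λ x → P? x ×-dec Q? x) xs) +
  length (filter (λ x → P? x ×-dec ¬? (Q? x)) xs) ≡ length (filter P? xs)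
count-split P? Q? List.[] = refl
count-split P? Q? (x List.∷ xs) with P? x | Q? x
... | yes _ | yes _ = cong suc (count-split P? Q? xs)
... | yes _ | no _  = trans (ℕ.+-suc _ _) (cong suc (count-split P? Q? xs))
... | no _  | yes _ = count-split P? Q? xs
... | no _  | no _  = count-split P? Q? xs

-- Finite sets and linear orders

-- Pigeonhole: if `y` were missed, punching it out of the codomain would inject `suc n` elements
-- into `n`.
injective⇒surjective : (f : Fin n → Fin n) → Injective _≡_ _≡_ f →
  ∀ y → ∃ λ x → f x ≡ y
injective⇒surjective {suc n} f inj y with Fin.any? (λ x → f x Fin.≟ y)
... | yes p = p
... | no ¬p = contradiction
  (Fin.injective⇒≤ {f = λ x → punchOut (λ y≡fx → ¬p (x , sym y≡fx))}
    (inj ∘ Fin.punchOut-injective {i = y} _ _))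
  ℕ.1+n≰n

-- A strictly increasing sequence of naturals gains at least one at each step; the induction runs on
-- the value of `i`.
monotone⇒inflationary : (f : Fin n → Fin n) → (∀ {i j} → i Fin.< j → f i Fin.< f j) →
  ∀ i → i Fin.≤ f i
monotone⇒inflationary {n} f mono i = go (toℕ i) i refl
  where
  go : ∀ k i → toℕ i ≡ k → k ≤ toℕ (f i)
  go zero    i _  = z≤n
  go (suc k) i eq =
    ℕ.≤-<-trans (go k i⁻ i⁻≡k) (mono (ℕ.≤-reflexive (trans (cong suc i⁻≡k) (sym eq))))
    where
    k<n : k < n
    k<n = ℕ.<-trans (ℕ.n<1+n k) (subst (_< n) eq (Fin.toℕ<n i))
    i⁻ : Fin n
    i⁻ = fromℕ< k<n
    i⁻≡k : toℕ i⁻ ≡ k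
    i⁻≡k = Fin.toℕ-fromℕ< k<n

module _ (S : StrictTotalOrder 0ℓ 0ℓ 0ℓ) where
  open StrictTotalOrder S renaming (_<_ to _≺_; trans to ≺-trans)

  Increasing : (Fin n → Carrier) → Set
  Increasing f = ∀ {i j} → i Fin.< j → f i ≺ f j

  increasing⇒injective : (f : Fin n → Carrier) → Increasing f → Injective _≡_ _≈_ f
  increasing⇒injective f inc {i} {j} eq with Fin.<-cmp i j
  ... | tri< i<j _ _  = contradiction (inc i<j) (irrefl eq)
  ... | tri≈ _ i≡j _  = i≡j
  ... | tri> _ _ j<i  = contradiction (inc j<i) (irrefl (Eq.sym eq))

  increasing-reflects-< : (f : Fin n → Carrier) → Increasing f →
    ∀ {i j} → f i ≺ f j → i Fin.< j
  increasing-reflects-< f inc {i} {j} fi≺fj with Fin.<-cmp i j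
  ... | tri< i<j _ _    = i<j
  ... | tri≈ _ refl _   = contradiction fi≺fj (irrefl Eq.refl)
  ... | tri> _ _ j<i    = contradiction fi≺fj (asym (inc j<i))

  minimum : (f : Fin (suc n) → Carrier) → ∃ λ i → ∀ j → ¬ f j ≺ f i
  minimum {zero} f = zero , λ { zero → irrefl Eq.refl }
  minimum {suc n} f with minimum (f ∘ suc)
  ... | i , min with compare (f zero) (f (suc i))
  ... | tri< lt _ _ = zero ,
    λ { zero → irrefl Eq.refl ; (suc j) fj≺f0 → min j (≺-trans fj≺f0 lt) }
  ... | tri≈ ≮ _ _  = suc i , λ { zero → ≮ ; (suc j) → min j }
  ... | tri> ≮ _ _  = suc i , λ { zero → ≮ ; (suc j) → min j }

  -- Selection sort: a least element goes first, and injectivity turns "not larger" into "strictly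
  -- smaller" than each of the rest.
  sort : (f : Fin n → Carrier) → Injective _≡_ _≈_ f →
    ∃ λ (π : Fin n → Fin n) → Increasing (f ∘ π)
  sort {zero}  f inj = (λ ()) , λ { {()} }
  sort {suc n} f inj with minimum f
  ... | least , least-min
    with sort (f ∘ punchIn least) (Fin.punchIn-injective least _ _ ∘ inj)
  ... | π , inc = π⁺ , inc⁺
    where
    π⁺ : Fin (suc n) → Fin (suc n)
    π⁺ zero    = least
    π⁺ (suc i) = punchIn least (π i)

    inc⁺ : Increasing (f ∘ π⁺)
    inc⁺ {zero}  {suc j} _ with compare (f least) (f (punchIn least (π j)))
    ... | tri< lt _ _ = lt
    ... | tri≈ _ eq _ = contradiction (sym (inj eq)) (Fin.punchInᵢ≢i least (π j))
    ... | tri> _ _ gt = contradiction gt (least-min _)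
    inc⁺ {suc i} {suc j} (s≤s i<j) = inc i<j

  -- The reindexings `σ⁻¹ ∘ π` and `π⁻¹ ∘ σ` are strictly increasing, hence both inflationary. Being
  -- inverse to each other, they are the identity.
  sort-unique : (f : Fin n → Carrier) {π σ : Fin n → Fin n} →
    Injective _≡_ _≡_ π → Injective _≡_ _≡_ σ →
    Increasing (f ∘ π) → Increasing (f ∘ σ) → ∀ i → π i ≡ σ i
  sort-unique {n} f {π} {σ} π-inj σ-inj π-inc σ-inc i =
    trans (sym (index-correct σ-inj (π i))) (cong σ (Fin.≤-antisym
      (subst (τ i Fin.≤_) τ⁻τi≡i (inflationary π-inj σ-inc π-inc (τ i)))
      (inflationary σ-inj π-inc σ-inc i)))
    where
    index : {ρ : Fin n → Fin n} → Injective _≡_ _≡_ ρ → Fin n → Fin n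
    index ρ-inj y = proj₁ (injective⇒surjective _ ρ-inj y)

    index-correct : {ρ : Fin n → Fin n} (ρ-inj : Injective _≡_ _≡_ ρ) → ∀ y → ρ (index ρ-inj y) ≡ y
    index-correct ρ-inj y = proj₂ (injective⇒surjective _ ρ-inj y)

    inflationary : ∀ {π σ} (σ-inj : Injective _≡_ _≡_ σ) →
      Increasing (f ∘ π) → Increasing (f ∘ σ) → ∀ i → i Fin.≤ index σ-inj (π i)
    inflationary {π} {σ} σ-inj π-inc σ-inc = monotone⇒inflationary _ λ {i} {j} i<j →
      increasing-reflects-< (f ∘ σ) σ-inc
        (subst₂ (λ u v → f u ≺ f v) (sym (index-correct σ-inj (π i)))
          (sym (index-correct σ-inj (π j))) (π-inc i<j))

    τ : Fin n → Fin n
    τ j = index σ-inj (π j)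

    τ⁻τi≡i : index π-inj (σ (τ i)) ≡ i
    τ⁻τi≡i = π-inj (trans (index-correct π-inj (σ (τ i))) (index-correct σ-inj (π i)))

IsGreatest : Pred (Fin n) 0ℓ → Fin n → Set
IsGreatest P m = P m × (∀ {w} → P w → w Fin.≤ m)

greatest : {P : Pred (Fin n) 0ℓ} → Decidable P → ∃ P → ∃ (IsGreatest P)
greatest {suc n} P? (x , px) with Fin.any? (P? ∘ suc)
... | yes ∃P = let m , pm , max = greatest (P? ∘ suc) ∃P in
  suc m , pm , λ { {zero} _ → z≤n ; {suc w} pw → s≤s (max pw) }
greatest {suc n} P? (zero , p0) | no ∄P =
  zero , p0 , λ { {zero} _ → z≤n ; {suc w} pw → contradiction (w , pw) ∄P }
greatest {suc n} P? (suc x , px) | no ∄P = contradiction (x , px) ∄P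

greatest-unique : {P : Pred (Fin n) 0ℓ} {u v : Fin n} →
  IsGreatest P u → IsGreatest P v → u ≡ v
greatest-unique (pu , u-max) (pv , v-max) = Fin.≤-antisym (v-max pu) (u-max pv)

vec-ext : {xs ys : Vec A n} → (∀ i → lookup xs i ≡ lookup ys i) → xs ≡ ys
vec-ext {xs = xs} {ys} eq =
  trans (sym (tabulate∘lookup xs)) (trans (tabulate-cong eq) (tabulate∘lookup ys))

-- Patterns

⇔-true : A → B → A ⇔ B
⇔-true a b = mk⇔ (const b) (const a)

⇔-false : ¬ A → ¬ B → A ⇔ B
⇔-false ¬a ¬b = mk⇔ (⊥-elim ∘ ¬a) (⊥-elim ∘ ¬b)

orderIsomorphic-213 : ∀ {a b c} → b < a → a < c →
  OrderIsomorphic (a ∷ b ∷ c ∷ []) (2 ∷ 1 ∷ 3 ∷ [])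
orderIsomorphic-213 b<a a<c = λ where
  zero             zero             → ⇔-false (ℕ.<-irrefl refl) (ℕ.<-irrefl refl)
  zero             (suc zero)       → ⇔-false (ℕ.<-asym b<a) (λ { (s≤s ()) })
  zero             (suc (suc zero)) → ⇔-true a<c ℕ.≤-refl
  (suc zero)       zero             → ⇔-true b<a ℕ.≤-refl
  (suc zero)       (suc zero)       → ⇔-false (ℕ.<-irrefl refl) (ℕ.<-irrefl refl)
  (suc zero)       (suc (suc zero)) → ⇔-true (ℕ.<-trans b<a a<c) (s≤s (s≤s z≤n))
  (suc (suc zero)) zero             → ⇔-false (ℕ.<-asym a<c) (λ { (s≤s (s≤s ())) })
  (suc (suc zero)) (suc zero)       → ⇔-false (ℕ.<-asym (ℕ.<-trans b<a a<c)) (λ { (s≤s ()) })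
  (suc (suc zero)) (suc (suc zero)) → ⇔-false (ℕ.<-irrefl refl) (ℕ.<-irrefl refl)

-- An occurrence of 21-3 is expressed by two comparisons, the third following by transitivity.
Avoids : (Fin n → Fin n) → Set
Avoids f = ∀ {i i⁺ j} → toℕ i⁺ ≡ suc (toℕ i) → i⁺ Fin.< j →
  f i⁺ Fin.< f i → ¬ f i Fin.< f j

avoids-lookup⁺ : {π : Word n} → Avoids21-3 π → Avoids (lookup π)
avoids-lookup⁺ av {i} {i⁺} {j} eq i⁺<j desc asc =
  av (i , i⁺ , j , eq , i⁺<j , orderIsomorphic-213 desc asc)

avoids-lookup⁻ : {π : Word n} → Avoids (lookup π) → Avoids21-3 π
avoids-lookup⁻ av (i , i⁺ , j , eq , i⁺<j , iso) =
  av {i} eq i⁺<j (from (iso (suc zero) zero) ℕ.≤-refl) (from (iso zero (suc (suc zero))) ℕ.≤-refl)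

AvoidingPermutation : Word n → Set
AvoidingPermutation π = IsPermutation π × Avoids21-3 π

avoidingPermutation? : Decidable (AvoidingPermutation {n})
avoidingPermutation? π = isPermutation? π ×-dec avoids21-3? π

-- Suffix maxima

module _ (f : Fin n → Fin n) where

  OccursFrom : Fin n → Pred (Fin n) 0ℓ
  OccursFrom i w = ∃ λ j → i Fin.≤ j × f j ≡ w

  private
    suffix : ∀ i → ∃ (IsGreatest (OccursFrom i))
    suffix i = greatest (λ w → Fin.any? λ j → (i Fin.≤? j) ×-dec (f j Fin.≟ w))
      (f i , i , ℕ.≤-refl , refl)

  -- The `Sᵢ` of the outline. Its value serves as the name of the block that contains the letter at
  -- position `i`.
  suffixMax : Fin n → Fin n
  suffixMax i = proj₁ (suffix i)

  suffixMax-isGreatest : ∀ i → IsGreatest (OccursFrom i) (suffixMax i)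
  suffixMax-isGreatest i = proj₂ (suffix i)

  suffixMax-upper : ∀ {i j} → i Fin.≤ j → f j Fin.≤ suffixMax i
  suffixMax-upper {i} i≤j = proj₂ (suffixMax-isGreatest i) (_ , i≤j , refl)

  suffixMax-antitone : ∀ {i j} → i Fin.≤ j → suffixMax j Fin.≤ suffixMax i
  suffixMax-antitone {i} {j} i≤j with suffixMax-isGreatest j
  ... | (k , j≤k , fk≡) , _ =
    subst (Fin._≤ suffixMax i) fk≡ (suffixMax-upper (ℕ.≤-trans i≤j j≤k))

  -- Suffix maxima decrease weakly, so equality at the two ends spreads to every position between
  -- them. This reduces the claim to adjacent positions, where a descent would form 21-3 with the
  -- maximum still to come.
  suffixMax-eq⇒< : Injective _≡_ _≡_ f → Avoids f →
    ∀ {i j} → i Fin.< j → suffixMax i ≡ suffixMax j → f i Fin.< f j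
  suffixMax-eq⇒< inj av {i} {j} i<j =
    -- The recursion is on the number of positions strictly between `i` and `j`.
    go (toℕ j ∸ suc (toℕ i)) (sym (ℕ.m∸n+n≡m i<j))
    where
    step : ∀ {i i⁺} → toℕ i⁺ ≡ suc (toℕ i) → suffixMax i ≡ suffixMax i⁺ → f i Fin.< f i⁺
    step {i} {i⁺} adj eq with Fin.<-cmp (f i) (f i⁺)
    ... | tri< lt _ _ = lt
    ... | tri≈ _ fi≡ _ = contradiction (trans (sym adj) (cong toℕ (sym (inj fi≡)))) ℕ.1+n≢n
    -- The common suffix maximum sits at some `k` from `i⁺` on. It is at least `f i`, which exceeds
    -- `f i⁺`, so `k` lies beyond `i⁺` and can play the 3.
    ... | tri> _ _ gt with suffixMax-isGreatest i⁺
    ... | (k , i⁺≤k , fk≡) , _ = contradiction fi<fk (av adj i⁺<k gt)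
      where
      fi≤fk : f i Fin.≤ f k
      fi≤fk = subst (f i Fin.≤_) (trans eq (sym fk≡)) (suffixMax-upper ℕ.≤-refl)
      i⁺<k : i⁺ Fin.< k
      i⁺<k = Fin.≤∧≢⇒< i⁺≤k λ { refl → ℕ.<⇒≱ gt fi≤fk }
      fi<fk : f i Fin.< f k
      fi<fk = Fin.≤∧≢⇒< fi≤fk λ fi≡fk → ℕ.<⇒≢
        (ℕ.<-trans (ℕ.≤-reflexive (sym adj)) i⁺<k) (cong toℕ (inj fi≡fk))

    go : ∀ d {i j} → toℕ j ≡ d + suc (toℕ i) → suffixMax i ≡ suffixMax j → f i Fin.< f j
    go zero adj eq = step adj eq
    go (suc d) {i} {j} dist eq =
      ℕ.<-trans (step adj (trans eq (sym eq⁺))) (go d dist⁺ eq⁺)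
      where
      i<n : suc (toℕ i) < n
      i<n = ℕ.≤-<-trans (ℕ.m≤n+m _ (suc d)) (subst (_< n) dist (Fin.toℕ<n j))
      i⁺ : Fin n
      i⁺ = fromℕ< i<n
      adj : toℕ i⁺ ≡ suc (toℕ i)
      adj = Fin.toℕ-fromℕ< i<n
      dist⁺ : toℕ j ≡ d + suc (toℕ i⁺)
      dist⁺ = trans dist (sym (trans (cong (λ x → d + suc x) adj) (ℕ.+-suc d _)))
      i⁺≤j : i⁺ Fin.≤ j
      i⁺≤j = subst (toℕ i⁺ ≤_) (sym dist⁺) (ℕ.≤-trans (ℕ.n≤1+n _) (ℕ.m≤n+m _ d))
      eq⁺ : suffixMax i⁺ ≡ suffixMax j
      eq⁺ = Fin.≤-antisym
        (subst (suffixMax i⁺ Fin.≤_) eq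
          (suffixMax-antitone (subst (toℕ i ≤_) (sym adj) (ℕ.n≤1+n _))))
        (suffixMax-antitone i⁺≤j)

-- Avoiding permutations and equivalence relations

-- The matrix relates letters, whereas suffix maxima belong to positions; `lookup π` passes from the
-- latter to the former.
Encodes : Word n → Matrix n → Set
Encodes π R = ∀ i j →
  Related R (lookup π i) (lookup π j) ⇔
  suffixMax (lookup π) i ≡ suffixMax (lookup π) j

lookup-injective : {π : Word n} → IsPermutation π → Injective _≡_ _≡_ (lookup π)
lookup-injective π! = Vec.lookup-injective π! _ _

lookup-surjective : {π : Word n} → IsPermutation π → ∀ u → ∃ λ i → lookup π i ≡ u
lookup-surjective π! = injective⇒surjective _ (lookup-injective π!)

isPermutation-lookup⁻ : {π : Word n} → Injective _≡_ _≡_ (lookup π) → IsPermutation π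
isPermutation-lookup⁻ {π = π} inj = subst IsPermutation (tabulate∘lookup π) (Vec.tabulate⁺ inj)

relationMatrix : {Q : Fin n → Fin n → Set} → (∀ u v → Dec (Q u v)) →
  ∃ λ (R : Matrix n) → ∀ u v → Related R u v ⇔ Q u v
relationMatrix {Q = Q} Q? = tabulate (λ u → tabulate λ v → ⌊ Q? u v ⌋) , λ u v →
  subst (λ b → T b ⇔ Q u v)
    (sym (trans (cong (λ row → lookup row v) (lookup∘tabulate _ u)) (lookup∘tabulate _ v)))
    (mk⇔ toWitness fromWitness)

T-⇔⇒≡ : ∀ {a b} → T a ⇔ T b → a ≡ b
T-⇔⇒≡ {true}  {true}  _ = refl
T-⇔⇒≡ {true}  {false} e = ⊥-elim (to e _)
T-⇔⇒≡ {false} {true}  e = ⊥-elim (from e _)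
T-⇔⇒≡ {false} {false} _ = refl

-- Each letter is labelled by the suffix maximum at its position, and the relation is equality of
-- labels.
encoding-exists : {π : Word n} → IsPermutation π →
  ∃ λ R → IsEquivalence (Related R) × Encodes π R
encoding-exists {n} {π} π! = R , isEquivalence , encodes
  where
  index : Fin n → Fin n
  index u = proj₁ (lookup-surjective π! u)

  label : Fin n → Fin n
  label u = suffixMax (lookup π) (index u)

  label-lookup : ∀ i → label (lookup π i) ≡ suffixMax (lookup π) i
  label-lookup i = cong (suffixMax (lookup π))
    (lookup-injective π! (proj₂ (lookup-surjective π! (lookup π i))))

  R : Matrix n
  R = proj₁ (relationMatrix (λ u v → label u Fin.≟ label v))

  R⇔ : ∀ u v → Related R u v ⇔ label u ≡ label v
  R⇔ = proj₂ (relationMatrix (λ u v → label u Fin.≟ label v))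

  isEquivalence : IsEquivalence (Related R)
  isEquivalence = record
    { refl  = from (R⇔ _ _) refl
    ; sym   = λ p → from (R⇔ _ _) (sym (to (R⇔ _ _) p))
    ; trans = λ p q → from (R⇔ _ _) (trans (to (R⇔ _ _) p) (to (R⇔ _ _) q))
    }

  encodes : Encodes π R
  encodes i j = mk⇔
    (λ r → trans (sym (label-lookup i)) (trans (to (R⇔ _ _) r) (label-lookup j)))
    (λ eq → from (R⇔ _ _) (trans (label-lookup i) (trans eq (sym (label-lookup j)))))

-- Every letter occurs in `π`, so `Encodes` fixes the truth of every matrix entry.
encoding-unique : {π : Word n} {R R′ : Matrix n} → IsPermutation π →
  Encodes π R → Encodes π R′ → R ≡ R′
encoding-unique {π = π} {R} {R′} π! enc enc′ = vec-ext λ u → vec-ext λ v → entry u v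
  where
  entry : ∀ u v → lookup (lookup R u) v ≡ lookup (lookup R′ u) v
  entry u v with lookup-surjective π! u | lookup-surjective π! v
  ... | i , refl | j , refl = T-⇔⇒≡ (mk⇔
    (from (enc′ i j) ∘ to (enc i j)) (from (enc i j) ∘ to (enc′ i j)))

-- From a partition back to its avoiding permutation

module Blocks {R : Matrix n} (equiv : IsEquivalence (Related R)) where
  private module R = IsEquivalence equiv

  private
    block : ∀ u → ∃ (IsGreatest (Related R u))
    block u = greatest (λ v → T? (lookup (lookup R u) v)) (u , R.refl)

  blockMax : Fin n → Fin n
  blockMax u = proj₁ (block u)

  blockMax-isGreatest : ∀ u → IsGreatest (Related R u) (blockMax u)
  blockMax-isGreatest u = proj₂ (block u)

  blockMax-upper : ∀ u → u Fin.≤ blockMax u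
  blockMax-upper u = proj₂ (blockMax-isGreatest u) R.refl

  -- The maximum is a canonical representative of its block, so it turns relatedness into an
  -- equation.
  related⇔blockMax : ∀ {u v} → Related R u v ⇔ blockMax u ≡ blockMax v
  related⇔blockMax {u} {v} = mk⇔
    (λ r → greatest-unique (blockMax-isGreatest u)
      (R.trans r (proj₁ (blockMax-isGreatest v)) ,
       λ r′ → proj₂ (blockMax-isGreatest v) (R.trans (R.sym r) r′)))
    (λ eq → R.trans (proj₁ (blockMax-isGreatest u))
      (R.sym (subst (Related R v) (sym eq) (proj₁ (blockMax-isGreatest v)))))

  blockMax-idem : ∀ u → blockMax (blockMax u) ≡ blockMax u
  blockMax-idem u = sym (to related⇔blockMax (proj₁ (blockMax-isGreatest u)))

  -- Lexicographic, with the first coordinate reversed: sorting by it lists the blocks by decreasing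
  -- maximum and each block in increasing order.
  blockOrder : StrictTotalOrder 0ℓ 0ℓ 0ℓ
  blockOrder = On.strictTotalOrder
    (×-strictTotalOrder (Flip.strictTotalOrder (Fin.<-strictTotalOrder n)) (Fin.<-strictTotalOrder n))
    (λ u → blockMax u , u)

  open StrictTotalOrder blockOrder using () renaming (_<_ to _≺_)

  ≺⇒≥ : ∀ {u v} → u ≺ v → blockMax v Fin.≤ blockMax u
  ≺⇒≥ (inj₁ lt)       = ℕ.<⇒≤ lt
  ≺⇒≥ (inj₂ (eq , _)) = ℕ.≤-reflexive (cong toℕ (sym eq))

  ≺⇒< : ∀ {u v} → u ≺ v → blockMax u ≡ blockMax v → u Fin.< v
  ≺⇒< (inj₁ lt)       eq = contradiction (cong toℕ (sym eq)) (ℕ.<⇒≢ lt)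
  ≺⇒< (inj₂ (_ , lt)) _  = lt

  module _ {π : Word n} (π! : IsPermutation π) where

    -- Two parts: the suffix maximum belongs to the block of the letter, and it bounds that block
    -- because each related letter is at most its own, equal suffix maximum.
    encodes⇒blockMax : Encodes π R → ∀ i → blockMax (lookup π i) ≡ suffixMax (lookup π) i
    encodes⇒blockMax enc i = greatest-unique (blockMax-isGreatest (lookup π i)) (member , upper)
      where
      f = lookup π

      member : Related R (f i) (suffixMax f i)
      member with suffixMax-isGreatest f i
      -- At the position `j` where the maximum is attained, the suffix maximum is at least `f j`
      -- and, by antitonicity, at most the one at `i`; so the two agree.
      ... | (j , i≤j , fj≡) , _ = subst (Related R (f i)) fj≡ (from (enc i j) (Fin.≤-antisym
        (subst (Fin._≤ suffixMax f j) fj≡ (suffixMax-upper f ℕ.≤-refl))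
        (suffixMax-antitone f i≤j)))

      upper : ∀ {w} → Related R (f i) w → w Fin.≤ suffixMax f i
      upper {w} r with lookup-surjective π! w
      ... | j , refl = subst (f j Fin.≤_) (sym (to (enc i j) r)) (suffixMax-upper f ℕ.≤-refl)

    -- Block maxima are suffix maxima, hence weakly decreasing along `π`; ties are settled by
    -- `suffixMax-eq⇒<`, the point where avoidance enters.
    encodes⇒increasing : Avoids21-3 π → Encodes π R → Increasing blockOrder (lookup π)
    encodes⇒increasing av enc {i} {j} i<j
      with Fin.<-cmp (suffixMax (lookup π) j) (suffixMax (lookup π) i)
    ... | tri< lt _ _ = inj₁ (subst₂ Fin._<_
            (sym (encodes⇒blockMax enc j)) (sym (encodes⇒blockMax enc i)) lt)
    ... | tri≈ _ eq _ = inj₂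
            ( trans (encodes⇒blockMax enc i) (trans (sym eq) (sym (encodes⇒blockMax enc j)))
            , suffixMax-eq⇒< (lookup π) (lookup-injective π!) (avoids-lookup⁺ {π = π} av) i<j (sym eq))
    ... | tri> _ _ gt = contradiction (suffixMax-antitone (lookup π) (ℕ.<⇒≤ i<j)) (ℕ.<⇒≱ gt)

    module _ (inc : Increasing blockOrder (lookup π)) where

      blockMax-antitone : ∀ {i j} → i Fin.≤ j →
        blockMax (lookup π j) Fin.≤ blockMax (lookup π i)
      blockMax-antitone {i} {j} i≤j with i Fin.≟ j
      ... | yes refl = ℕ.≤-refl
      ... | no i≢j   = ≺⇒≥ (inc (Fin.≤∧≢⇒< i≤j i≢j))

      -- Were the block maximum placed before position `i`, the increasing order inside a block
      -- would make it smaller than `lookup π i`.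
      blockMax-occurs : ∀ i → OccursFrom (lookup π) i (blockMax (lookup π i))
      blockMax-occurs i with lookup-surjective π! (blockMax (lookup π i))
      ... | j , πj≡ with i Fin.≤? j
      ... | yes i≤j = j , i≤j , πj≡
      ... | no i≰j  = contradiction
        (subst (lookup π i Fin.≤_) (sym πj≡) (blockMax-upper (lookup π i)))
        (ℕ.<⇒≱ (≺⇒< (inc (ℕ.≰⇒> i≰j))
          (trans (cong blockMax πj≡) (blockMax-idem (lookup π i)))))

      -- A later letter is at most its own block maximum, which is at most the block maximum at `i`;
      -- and the latter does occur from `i` on.
      increasing⇒blockMax : ∀ i → blockMax (lookup π i) ≡ suffixMax (lookup π) i
      increasing⇒blockMax i = greatest-unique
        (blockMax-occurs i ,
         λ { (j , i≤j , refl) → ℕ.≤-trans (blockMax-upper (lookup π j)) (blockMax-antitone i≤j) })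
        (suffixMax-isGreatest (lookup π) i)

      increasing⇒encodes : Encodes π R
      increasing⇒encodes i j = subst₂ (λ s t → Related R (lookup π i) (lookup π j) ⇔ s ≡ t)
        (increasing⇒blockMax i) (increasing⇒blockMax j) related⇔blockMax

      -- If the letter at `i` is its block maximum, it bounds all later letters, so no 3 can follow.
      -- Otherwise that maximum sits at some `k` from `i⁺` on; antitonicity then puts the letter at
      -- `i⁺` into the same block, and there can be no descent.
      increasing⇒avoids : Avoids (lookup π)
      increasing⇒avoids {i} {i⁺} {j} adj i⁺<j desc asc with blockMax-occurs i
      ... | k , i≤k , πk≡ with i Fin.≟ k
      ... | yes refl = ℕ.<⇒≱ asc (ℕ.≤-trans (blockMax-upper (lookup π j))
              (subst (blockMax (lookup π j) Fin.≤_) (sym πk≡)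
                (blockMax-antitone (ℕ.≤-trans (ℕ.<⇒≤ i<i⁺) (ℕ.<⇒≤ i⁺<j)))))
        where
        i<i⁺ : i Fin.< i⁺
        i<i⁺ = ℕ.≤-reflexive (sym adj)
      ... | no i≢k = ℕ.<-asym desc (≺⇒< (inc i<i⁺) (Fin.≤-antisym
              (subst (Fin._≤ blockMax (lookup π i⁺)) πk≡
                (ℕ.≤-trans (blockMax-upper (lookup π k)) (blockMax-antitone i⁺≤k)))
              (blockMax-antitone (ℕ.<⇒≤ i<i⁺))))
        where
        i<i⁺ : i Fin.< i⁺
        i<i⁺ = ℕ.≤-reflexive (sym adj)
        i⁺≤k : i⁺ Fin.≤ k
        i⁺≤k = subst (_≤ toℕ k) (sym adj) (Fin.≤∧≢⇒< i≤k i≢k)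

  encoded-exists : ∃ λ π → AvoidingPermutation π × Encodes π R
  -- Equality in `blockOrder` is componentwise on pairs, so `proj₂` recovers equality of letters.
  encoded-exists with sort blockOrder (λ u → u) proj₂
  ... | ρ , ρ-inc =
    π , (π! , avoids-lookup⁻ {π = π} (increasing⇒avoids π! inc)) , increasing⇒encodes π! inc
    where
    π : Word n
    π = tabulate ρ
    inc : Increasing blockOrder (lookup π)
    inc {i} {j} i<j = subst₂ _≺_ (sym (lookup∘tabulate ρ i)) (sym (lookup∘tabulate ρ j)) (ρ-inc i<j)
    π! : IsPermutation π
    π! = isPermutation-lookup⁻ λ {i} {j} eq →
      increasing⇒injective blockOrder (lookup π) inc (cong blockMax eq , eq)

  -- Both words sort the letters by the same `blockOrder`, and sorting is unique.
  encoded-unique : ∀ {π σ} → AvoidingPermutation π → AvoidingPermutation σ →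
    Encodes π R → Encodes σ R → π ≡ σ
  encoded-unique {π} {σ} (π! , π-av) (σ! , σ-av) π-enc σ-enc = vec-ext
    (sort-unique blockOrder (λ u → u) (lookup-injective π!) (lookup-injective σ!)
      (encodes⇒increasing π! π-av π-enc) (encodes⇒increasing σ! σ-av σ-enc))

words : ∀ n → List (Word n)
words n = vectors (allFin n) n

words-enumerates : ∀ n → Enumerates (words n)
words-enumerates n = vectors-enumerates (allFin-enumerates n) n

count-avoiding : ∀ n → length (filter avoidingPermutation? (words n)) ≡ bell n
count-avoiding n = count-≡ avoidingPermutation? isEquivalence? Encodes
  (words-enumerates n)
  (vectors-enumerates (vectors-enumerates bools-enumerates n) n)
  (encoding-exists ∘ proj₁)
  (λ {R} equiv → Blocks.encoded-exists {R = R} equiv)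
  (λ {π} {σ} {R} π-ok σ-ok equiv → Blocks.encoded-unique {R = R} equiv {π} {σ} π-ok σ-ok)
  (λ {π} _ _ (π! , _) → encoding-unique {π = π} π!)

-- Prefixes

begins12⁺ : {x y : Fin (suc (suc n))} {zs : Vec (Fin (suc (suc n))) n} → x Fin.< y →
  BeginsWith (1 ∷ 2 ∷ []) (x ∷ y ∷ zs)
begins12⁺ x<y = s≤s (s≤s z≤n) , λ where
  zero       zero       → ⇔-false (ℕ.<-irrefl refl) (ℕ.<-irrefl refl)
  zero       (suc zero) → ⇔-true x<y ℕ.≤-refl
  (suc zero) zero       → ⇔-false (ℕ.<-asym x<y) (λ { (s≤s ()) })
  (suc zero) (suc zero) → ⇔-false (ℕ.<-irrefl refl) (ℕ.<-irrefl refl)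

max-first⇒¬begins12 : (xs : Vec (Fin (suc n)) n) → ¬ BeginsWith (1 ∷ 2 ∷ []) (fromℕ n ∷ xs)
max-first⇒¬begins12 []       (s≤s () , _)
max-first⇒¬begins12 (y ∷ ys) (s≤s (s≤s z≤n) , iso) =
  ℕ.<⇒≱ (from (iso zero (suc zero)) ℕ.≤-refl) (Fin.≤fromℕ y)

-- If the largest letter is not first, the word starts with a descent. The largest letter cannot be
-- the lower end of that descent, and any later place makes it the 3 of a 21-3.
¬begins12⇒max-first : {x : Fin (suc n)} {xs : Vec (Fin (suc n)) n} →
  AvoidingPermutation (x ∷ xs) → ¬ BeginsWith (1 ∷ 2 ∷ []) (x ∷ xs) → x ≡ fromℕ n
¬begins12⇒max-first {n} (π! , _) _ with lookup-surjective π! (fromℕ n)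
¬begins12⇒max-first _ _ | zero , x≡max = x≡max
¬begins12⇒max-first {n} {x} {y ∷ ys} (π! , av) ¬12 | suc k , max with Fin.<-cmp x y
... | tri< x<y _ _ = contradiction (begins12⁺ x<y) ¬12
... | tri≈ _ x≡y _ = contradiction (lookup-injective π! {zero} {suc zero} x≡y) λ ()
... | tri> _ _ y<x = contradiction x<max (not-below k max)
  where
  x<max : x Fin.< fromℕ n
  x<max = Fin.≤∧≢⇒< (Fin.≤fromℕ x)
    λ x≡max → contradiction (lookup-injective π! {zero} {suc k} (trans x≡max (sym max))) λ ()

  not-below : ∀ k → lookup (y ∷ ys) k ≡ fromℕ n → ¬ x Fin.< fromℕ n
  not-below zero    refl _  = ℕ.<⇒≱ y<x (Fin.≤fromℕ x)
  not-below (suc k) eq   lt = avoids-lookup⁺ {π = x ∷ y ∷ ys} av {zero} {suc zero} {suc (suc k)}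
    refl (s≤s (s≤s z≤n)) y<x (subst (x Fin.<_) (sym eq) lt)

maxFirst : Word n → Word (suc n)
maxFirst {n} σ = fromℕ n ∷ map inject₁ σ

toℕ-lookup-maxFirst : (σ : Word n) (i : Fin n) →
  toℕ (lookup (maxFirst σ) (suc i)) ≡ toℕ (lookup σ i)
toℕ-lookup-maxFirst σ i = trans (cong toℕ (lookup-map i inject₁ σ)) (Fin.toℕ-inject₁ _)

maxFirst-injective : {σ τ : Word n} → maxFirst σ ≡ maxFirst τ → σ ≡ τ
maxFirst-injective {σ = σ} {τ} eq = vec-ext λ i → Fin.toℕ-injective
  (trans (sym (toℕ-lookup-maxFirst σ i))
    (trans (cong (λ π → toℕ (lookup π (suc i))) eq) (toℕ-lookup-maxFirst τ i)))

-- The new first letter could only play the 2, but nothing exceeds it; hence every occurrence of the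
-- pattern already lies in `σ`.
maxFirst-avoiding : {σ : Word n} → AvoidingPermutation σ → AvoidingPermutation (maxFirst σ)
maxFirst-avoiding {n} {σ} (σ! , av) =
  (VecAll.map⁺ (VecAll.universal (λ _ → Fin.fromℕ≢inject₁) σ) VecAllPairs.∷
    Vec.map⁺ Fin.inject₁-injective σ!) ,
  avoids-lookup⁻ {π = maxFirst σ} avoids
  where
  avoids : Avoids (lookup (maxFirst σ))
  avoids {zero}  {_}      {j}     _   _   _    max<  = ℕ.<⇒≱ max< (Fin.≤fromℕ (lookup (maxFirst σ) j))
  avoids {suc i} {suc i⁺} {suc j} adj lt desc asc = avoids-lookup⁺ {π = σ} av {i} {i⁺} {j}
    (ℕ.suc-injective adj) (s≤s⁻¹ lt)
    (subst₂ _<_ (toℕ-lookup-maxFirst σ i⁺) (toℕ-lookup-maxFirst σ i) desc)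
    (subst₂ _<_ (toℕ-lookup-maxFirst σ i) (toℕ-lookup-maxFirst σ j) asc)

maxFirst-avoiding⁻ : {σ : Word n} → AvoidingPermutation (maxFirst σ) → AvoidingPermutation σ
maxFirst-avoiding⁻ {σ = σ} (π! , av) =
  isPermutation-lookup⁻ (λ {i} {j} eq → Fin.suc-injective (lookup-injective π!
    (Fin.toℕ-injective (trans (toℕ-lookup-maxFirst σ i)
      (trans (cong toℕ eq) (sym (toℕ-lookup-maxFirst σ j))))))) ,
  avoids-lookup⁻ {π = σ} λ {i} {i⁺} {j} adj lt desc asc →
    avoids-lookup⁺ {π = maxFirst σ} av {suc i} {suc i⁺} {suc j} (cong suc adj) (s≤s lt)
      (subst₂ _<_ (sym (toℕ-lookup-maxFirst σ i⁺)) (sym (toℕ-lookup-maxFirst σ i)) desc)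
      (subst₂ _<_ (sym (toℕ-lookup-maxFirst σ i)) (sym (toℕ-lookup-maxFirst σ j)) asc)

-- Letters other than the largest fit into the smaller alphabet; this undoes `maxFirst`.
map-inject₁⁻¹ : (xs : Vec (Fin (suc m)) n) → VecAll.All (fromℕ m ≢_) xs →
  ∃ λ ys → xs ≡ map inject₁ ys
map-inject₁⁻¹ []       _                      = [] , refl
map-inject₁⁻¹ {m} (x ∷ xs) (max≢x VecAll.∷ max∉xs) =
  let ys , eq = map-inject₁⁻¹ xs max∉xs in
  lower₁ x m≢x ∷ ys , cong₂ _∷_ (sym (Fin.inject₁-lower₁ x m≢x)) eq
  where
  m≢x : m ≢ toℕ x
  m≢x m≡x = max≢x (Fin.toℕ-injective (trans (Fin.toℕ-fromℕ m) m≡x))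

¬begins12⇒maxFirst : {π : Word (suc n)} →
  AvoidingPermutation π × ¬ BeginsWith (1 ∷ 2 ∷ []) π →
  ∃ λ σ → AvoidingPermutation σ × π ≡ maxFirst σ
¬begins12⇒maxFirst {π = x ∷ xs} (π-ok , ¬12) with ¬begins12⇒max-first π-ok ¬12
¬begins12⇒maxFirst {π = x ∷ xs} (π-ok@(max∉xs VecAllPairs.∷ _ , _) , _) | refl
  with map-inject₁⁻¹ xs max∉xs
... | σ , refl = σ , maxFirst-avoiding⁻ π-ok , refl

count-¬begins12 : ∀ n →
  length (filter (λ π → avoidingPermutation? π ×-dec ¬? (beginsWith? (1 ∷ 2 ∷ []) π)) (words (suc n)))
  ≡ length (filter avoidingPermutation? (words n))
count-¬begins12 n = count-≡
  (λ π → avoidingPermutation? π ×-dec ¬? (beginsWith? (1 ∷ 2 ∷ []) π)) avoidingPermutation?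
  (λ π σ → π ≡ maxFirst σ) (words-enumerates (suc n)) (words-enumerates n)
  ¬begins12⇒maxFirst
  (λ {σ} σ-ok → maxFirst σ , (maxFirst-avoiding σ-ok , max-first⇒¬begins12 (map inject₁ σ)) , refl)
  (λ { _ _ _ refl refl → refl })
  (λ _ _ _ eq eq′ → maxFirst-injective (trans (sym eq) eq′))

N-avoiding : ∀ {k} (p : Vec ℕ k) n →
  N p n ≡ length (filter (λ π → avoidingPermutation? π ×-dec beginsWith? p π) (words n))
N-avoiding p n = cong length (filter-≐
  (λ π → isPermutation? π ×-dec avoids21-3? π ×-dec beginsWith? p π)
  (λ π → avoidingPermutation? π ×-dec beginsWith? p π)
  ((λ (a , b , c) → (a , b) , c) , (λ ((a , b) , c) → a , b , c)) (words n))

N-1 : ∀ n → N (1 ∷ []) (suc n) ≡ bell (suc n)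
N-1 n = trans
  (cong length (filter-≐ (λ π → isPermutation? π ×-dec avoids21-3? π ×-dec beginsWith? (1 ∷ []) π)
    avoidingPermutation?
    ((λ (π! , av , _) → π! , av) , λ {π} (π! , av) → π! , av , begins1 π) (words (suc n))))
  (count-avoiding (suc n))
  where
  begins1 : (π : Word (suc n)) → BeginsWith (1 ∷ []) π
  begins1 (x ∷ xs) = s≤s z≤n , λ { zero zero → ⇔-false (ℕ.<-irrefl refl) (ℕ.<-irrefl refl) }

-- Avoiding permutations are split by whether they begin with an ascent; those that do not are
-- counted by `bell n` through `maxFirst`. The additive form stays within the naturals.
N-12 : ∀ n → N (1 ∷ 2 ∷ []) (suc n) + bell n ≡ bell (suc n)
N-12 n = begin
  N (1 ∷ 2 ∷ []) (suc n) + bell n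
    ≡⟨ cong₂ _+_ (N-avoiding (1 ∷ 2 ∷ []) (suc n))
         (sym (trans (count-¬begins12 n) (count-avoiding n))) ⟩
  length (filter (λ π → avoidingPermutation? π ×-dec beginsWith? (1 ∷ 2 ∷ []) π) (words (suc n))) +
  length (filter (λ π → avoidingPermutation? π ×-dec ¬? (beginsWith? (1 ∷ 2 ∷ []) π)) (words (suc n)))
    ≡⟨ count-split avoidingPermutation? (beginsWith? (1 ∷ 2 ∷ [])) (words (suc n)) ⟩
  length (filter avoidingPermutation? (words (suc n)))
    ≡⟨ count-avoiding (suc n) ⟩
  bell (suc n) ∎
  where open ≡-Reasoning

lookup-∷ʳ-fromℕ : (xs : Vec A n) (x : A) → lookup (xs ∷ʳ x) (fromℕ n) ≡ x
lookup-∷ʳ-fromℕ []       x = refl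
lookup-∷ʳ-fromℕ (_ ∷ xs) x = lookup-∷ʳ-fromℕ xs x

-- The first two letters of the pattern are `2 + k` and `1 + k`, and its last is `3 + k`. The
-- corresponding letters of `π` form 21-3.
begins-descending⇒contains : ∀ {k} {π : Word n} →
  BeginsWith (descendingThenMax (3 + k)) π → ¬ Avoids (lookup π)
begins-descending⇒contains {n} {k} {π} (k≤n , iso) av =
  av {inject zero} {inject (suc zero)} {inject last}
    (trans (Fin.toℕ-inject≤ (suc zero) k≤n) (cong suc (sym (Fin.toℕ-inject≤ zero k≤n))))
    (subst₂ _<_ (sym (Fin.toℕ-inject≤ (suc zero) k≤n)) (sym (Fin.toℕ-inject≤ last k≤n))
      (s≤s (s≤s z≤n)))
    (transfer (suc zero) zero ℕ.≤-refl)
    (transfer zero last (ℕ.≤-reflexive (sym (lookup-∷ʳ-fromℕ (descending (2 + k)) (3 + k)))))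
  where
  inject : Fin (3 + k) → Fin n
  inject i = inject≤ i k≤n

  last : Fin (3 + k)
  last = fromℕ (2 + k)

  letter : ∀ i → lookup (truncate k≤n (map toℕ π)) i ≡ toℕ (lookup π (inject i))
  letter i = trans (lookup-truncate k≤n (map toℕ π) i) (lookup-map (inject i) toℕ π)

  transfer : ∀ i j → lookup (descendingThenMax (3 + k)) i < lookup (descendingThenMax (3 + k)) j →
    lookup π (inject i) Fin.< lookup π (inject j)
  transfer i j lt = subst₂ _<_ (letter i) (letter j) (from (iso i j) lt)

N-descending : ∀ k n → N (descendingThenMax (3 + k)) n ≡ 0
N-descending k n = cong length (filter-none
  (λ π → isPermutation? π ×-dec avoids21-3? π ×-dec beginsWith? (descendingThenMax (3 + k)) π)
  (All.universal
    (λ π (_ , av , begins) →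
      begins-descending⇒contains {k = k} {π} begins (avoids-lookup⁺ {π = π} av))
    (words n)))

proposition18 : ∀ (k n : ℕ) → 1 ≤ k → 1 ≤ n →
    (3 ≤ k → N (descendingThenMax k) n ≡ 0) ×
    (k ≡ 2 → + N (descendingThenMax k) n ≡ + bell n - + bell (n ∸ 1)) ×
    (k ≡ 1 → N (descendingThenMax k) n ≡ bell n)
proposition18 k (suc n) _ _ =
  (λ { (s≤s (s≤s (s≤s {n = k′} _))) → N-descending k′ (suc n) }) ,
  -- Adding and subtracting `bell n` over the integers brings the goal to the additive form of
  -- `N-12`.
  (λ { refl → begin
      + N (1 ∷ 2 ∷ []) (suc n)
        ≡⟨ ℤ.+-identityʳ _ ⟨
      + N (1 ∷ 2 ∷ []) (suc n) ℤ.+ + 0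
        ≡⟨ cong (λ z → + N (1 ∷ 2 ∷ []) (suc n) ℤ.+ z) (ℤ.+-inverseʳ (+ bell n)) ⟨
      + N (1 ∷ 2 ∷ []) (suc n) ℤ.+ (+ bell n - + bell n)
        ≡⟨ ℤ.+-assoc (+ N (1 ∷ 2 ∷ []) (suc n)) (+ bell n) (ℤ.- + bell n) ⟨
      + (N (1 ∷ 2 ∷ []) (suc n) + bell n) - + bell n
        ≡⟨ cong (λ b → + b - + bell n) (N-12 n) ⟩
      + bell (suc n) - + bell n ∎ }) ,
  (λ { refl → N-1 n })
  where open ≡-Reasoning
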